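{- $=^{\mathrm{ce}}\ <_{\mathrm{Learn}}\ E^{\mathrm{ce}}_0$.
   Context: Fix a standard (acceptable) enumeration $(\varphi_e)_{e\in\omega}$ of the partial computable functions and let $W_e=\operatorname{dom}(\varphi_e)$. Write $e=^{\mathrm{ce}}e'$ iff $W_e=W_{e'}$, and $e\mathrel{E^{\mathrm{ce}}_0}e'$ iff the symmetric difference $W_e\mathbin{\triangle}W_{e'}$ is finite. An enumeration of a set $A$ is a surjection $\mu:\omega\to A$; $\mu[s]$ denotes the finite string $\mu(0),\dots,\mu(s-1)$. A learner is an arbitrary function $\mathbf{M}:\omega^{<\omega}\to\omega$ (no effectivity is assumed). For an equivalence relation $E^{\mathrm{ce}}$ on $\omega$ extending $=^{\mathrm{ce}}$, a family $\mathfrak{K}$ of nonempty c.e. sets is $E^{\mathrm{ce}}$-learnable if there is a learner $\mathbf{M}$ such that for every $e$ with $W_e\in\mathfrak{K}$ and every enumeration $\mu$ of $W_e$ there is $i\in\omega$ with $i\mathrel{E^{\mathrm{ce}}}e$ and $\mathbf{M}(\mu[s])=i$ for all sufficiently large $s$. $E^{\mathrm{ce}}\leq_{\mathrm{Learn}}F^{\mathrm{ce}}$ means that every $E^{\mathrm{ce}}$-learnable family of nonempty c.e. sets is also $F^{\mathrm{ce}}$-learnable; $E^{\mathrm{ce}}<_{\mathrm{Learn}}F^{\mathrm{ce}}$ means $E^{\mathrm{ce}}\leq_{\mathrm{Learn}}F^{\mathrm{ce}}$ and $F^{\mathrm{ce}}\not\leq_{\mathrm{Learn}}E^{\mathrm{ce}}$.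 -}

module Defs where

open import Data.Empty using (⊥-elim)
open import Data.Fin using (Fin)
open import Data.List using (List; []; _++_; applyUpTo)
open import Data.List.Membership.DecPropositional using () renaming (_∈?_ to mem?)
open import Data.List.Membership.Propositional using () renaming (_∈_ to _∈ˡ_)
open import Data.List.Membership.Propositional.Properties using (∈-++⁺ˡ; ∈-++⁺ʳ)
open import Data.Nat using (ℕ; suc; _<_; _≤_; _≟_)
open import Data.Product using (∃; _×_; _,_)
open import Data.Sum using (inj₁; inj₂; swap)
open import Data.Vec using (Vec; []; _∷_; lookup)
open import Data.Vec.Relation.Binary.Pointwise.Inductive using (Pointwise)
open import Function using (_∘_)
open import Function.Bundles using (_⇔_)
open import Level using (0ℓ)
open import Relation.Binary using (Rel; REL; IsEquivalence; _⇒_; _Respects_)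
open import Relation.Binary.PropositionalEquality using (_≡_)
open import Relation.Nullary using (¬_; yes; no)
open import Relation.Unary using (Pred; _∈_; _∉_; _⊆_; _≐_; _∖_; _∪_; Satisfiable)
open import Relation.Unary.Properties using (≐-refl; ≐-sym; ≐-trans)

-- Kleene's μ-recursive functions of n arguments.
data Code : ℕ → Set where
  zeroᶜ : Code 0
  sucᶜ  : Code 1
  projᶜ : ∀ {n} → Fin n → Code n
  compᶜ : ∀ {m n} → Code m → Vec (Code n) m → Code n
  recᶜ  : ∀ {n} → Code n → Code (suc (suc n)) → Code (suc n)
  minᶜ  : ∀ {n} → Code (suc n) → Code n

-- c [ xs ]⇓ y : the computation of c on xs converges with value y.
infix 4 _[_]⇓_
data _[_]⇓_ : ∀ {n} → Code n → Vec ℕ n → ℕ → Set where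
  zero⇓ : zeroᶜ [ [] ]⇓ 0
  suc⇓  : ∀ {x} → sucᶜ [ x ∷ [] ]⇓ suc x
  proj⇓ : ∀ {n} {xs : Vec ℕ n} (i : Fin n) → projᶜ i [ xs ]⇓ lookup xs i
  comp⇓ : ∀ {m n} {f : Code m} {gs : Vec (Code n) m} {xs ys y} →
          Pointwise (λ g z → g [ xs ]⇓ z) gs ys → f [ ys ]⇓ y →
          compᶜ f gs [ xs ]⇓ y
  rec⇓0 : ∀ {n} {f : Code n} {g xs y} →
          f [ xs ]⇓ y → recᶜ f g [ 0 ∷ xs ]⇓ y
  rec⇓+ : ∀ {n} {f : Code n} {g k xs r y} →
          recᶜ f g [ k ∷ xs ]⇓ r → g [ k ∷ r ∷ xs ]⇓ y →
          recᶜ f g [ suc k ∷ xs ]⇓ y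
  min⇓  : ∀ {n} {f : Code (suc n)} {xs y} →
          f [ y ∷ xs ]⇓ 0 →
          (∀ {z} → z < y → ∃ λ k → f [ z ∷ xs ]⇓ suc k) →
          minᶜ f [ xs ]⇓ y

Computable : (ℕ → ℕ) → Set
Computable f = ∃ λ (c : Code 1) → ∀ x → c [ x ∷ [] ]⇓ f x

-- Acceptable numberings of the unary partial computable functions: the
-- universal function (e , x) ↦ φ_e(x) is partial computable, and every
-- uniformly computable sequence of partial functions is translated into φ by
-- a total computable function on indices.  Partial functions are represented
-- by their graphs: φ e x y says that φ_e(x) converges to y.  That each graph
-- is single-valued, and that every unary partial computable function occurs,
-- follow from the two fields.
record AcceptableNumbering : Set₁ where
  field
    φ         : ℕ → REL ℕ ℕ 0ℓ
    universal : ∃ λ (u : Code 2) → ∀ e x y → φ e x y ⇔ u [ e ∷ x ∷ [] ]⇓ y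
    translate : ∀ (c : Code 2) → ∃ λ f → Computable f ×
                (∀ e x y → φ (f e) x y ⇔ c [ e ∷ x ∷ [] ]⇓ y)

  W : ℕ → Pred ℕ 0ℓ
  W e x = ∃ λ y → φ e x y

infixr 6 _△_
_△_ : Pred ℕ 0ℓ → Pred ℕ 0ℓ → Pred ℕ 0ℓ
A △ B = (A ∖ B) ∪ (B ∖ A)

-- Only containment in a finite list is required; asking for a list of exactly
-- the elements of A, which is classically equivalent, would amount
-- constructively to deciding membership in A.
Finite : Pred ℕ 0ℓ → Set
Finite A = ∃ λ xs → A ⊆ (_∈ˡ xs)

module _ (N : AcceptableNumbering) where
  open AcceptableNumbering N

  SameSet : Rel ℕ 0ℓ
  SameSet e e′ = W e ≐ W e′

  AlmostSameSet : Rel ℕ 0ℓ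
  AlmostSameSet e e′ = Finite (W e △ W e′)

  record CeEquivalence : Set₁ where
    field
      rel           : Rel ℕ 0ℓ
      isEquivalence : IsEquivalence rel
      extends       : SameSet ⇒ rel

  =ce : CeEquivalence
  =ce = record
    { rel           = SameSet
    ; isEquivalence = record { refl = ≐-refl ; sym = ≐-sym ; trans = ≐-trans }
    ; extends       = λ p → p
    }

private
  △-empty : ∀ {A B : Pred ℕ 0ℓ} → A ≐ B → Finite (A △ B)
  △-empty (A⊆B , B⊆A) = [] , λ
    { (inj₁ (a , ¬b)) → ⊥-elim (¬b (A⊆B a))
    ; (inj₂ (b , ¬a)) → ⊥-elim (¬a (B⊆A b)) }

  △-trans : ∀ {A B C : Pred ℕ 0ℓ} →
            Finite (A △ B) → Finite (B △ C) → Finite (A △ C)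
  △-trans {A} {B} {C} (xs , p) (ys , q) = xs ++ ys , cover
    where
    cover : A △ C ⊆ (_∈ˡ xs ++ ys)
    cover {x} d with mem? _≟_ x (xs ++ ys)
    ... | yes x∈ = x∈
    ... | no  x∉ = ⊥-elim (absurd d)
      where
      ¬AB : x ∉ A △ B
      ¬AB = x∉ ∘ ∈-++⁺ˡ ∘ p
      ¬BC : x ∉ B △ C
      ¬BC = x∉ ∘ ∈-++⁺ʳ xs ∘ q
      absurd : x ∉ A △ C
      absurd (inj₁ (a , ¬c)) = ¬AB (inj₁ (a , λ b → ¬BC (inj₁ (b , ¬c))))
      absurd (inj₂ (c , ¬a)) = ¬BC (inj₂ (c , λ b → ¬AB (inj₂ (b , ¬a))))

E₀ce : ∀ N → CeEquivalence N
E₀ce N = record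
  { rel           = AlmostSameSet N
  ; isEquivalence = record
      { refl  = △-empty ≐-refl
      ; sym   = λ (xs , p) → xs , p ∘ swap
      ; trans = △-trans
      }
  ; extends       = △-empty
  }

IsEnumerationOf : (ℕ → ℕ) → Pred ℕ 0ℓ → Set
IsEnumerationOf μ A = (∀ n → μ n ∈ A) × (∀ {x} → x ∈ A → ∃ λ n → μ n ≡ x)

Learner : Set
Learner = List ℕ → ℕ

module _ {N : AcceptableNumbering} where
  open AcceptableNumbering N

  -- Sets are predicates, so a family has to respect extensional equality.
  record IsFamilyOfNonemptyCeSets (𝔎 : Pred (Pred ℕ 0ℓ) 0ℓ) : Set₁ where
    field
      resp     : 𝔎 Respects _≐_
      nonempty : ∀ {A} → A ∈ 𝔎 → Satisfiable A
      ce       : ∀ {A} → A ∈ 𝔎 → ∃ λ e → A ≐ W e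

  Learnable : CeEquivalence N → Pred (Pred ℕ 0ℓ) 0ℓ → Set
  Learnable E 𝔎 = ∃ λ (M : Learner) →
    ∀ e → W e ∈ 𝔎 → ∀ μ → IsEnumerationOf μ (W e) →
    ∃ λ i → CeEquivalence.rel E i e ×
            (∃ λ s₀ → ∀ s → s₀ ≤ s → M (applyUpTo μ s) ≡ i)

  infix 4 _≤Learn_ _<Learn_

  _≤Learn_ : CeEquivalence N → CeEquivalence N → Set₁
  E ≤Learn F = ∀ 𝔎 → IsFamilyOfNonemptyCeSets 𝔎 → Learnable E 𝔎 → Learnable F 𝔎

  _<Learn_ : CeEquivalence N → CeEquivalence N → Set₁
  E <Learn F = E ≤Learn F × ¬ (F ≤Learn E)

{-# OPTIONS --safe #-}
module Submission where

open import Defs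
open import Data.Fin using (zero; suc)
open import Data.List using ([]; _∷_; applyUpTo)
open import Data.List.Relation.Unary.Any using (here)
open import Data.Empty using (⊥-elim)
open import Data.Nat
open import Data.Nat.Properties
open import Data.Product using (∃; _×_; _,_; proj₁; proj₂; map₂)
open import Data.Sum using (_⊎_; inj₁; inj₂)
open import Data.Unit using (tt)
open import Data.Vec using ([]; _∷_)
open import Data.Vec.Relation.Binary.Pointwise.Inductive using ([]; _∷_)
open import Function using (_∘_; const)
open import Function.Bundles using (Equivalence)
open import Level using (0ℓ)
open import Relation.Binary.PropositionalEquality
open import Relation.Nullary using (¬_; yes; no)
open import Relation.Unary using (Pred; _∈_; _≐_; U)
open import Relation.Unary.Properties using (≐-sym; ≐-trans)

-- The family consists of ω and of all the sets ω ∖ {n}.  A constant guess for ω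
-- is correct up to one element.  A learner up to equality is defeated by a text
-- built in stages: stage k extends the current string, through an enumeration
-- of ω ∖ {n} for a fresh n, until the learner outputs an index of ω ∖ {n}, and
-- then appends k.  The limit text enumerates ω, while the learner outputs
-- indices of proper subsets of ω infinitely often.

Dom : Code 1 → Pred ℕ 0ℓ
Dom c x = ∃ λ y → c [ x ∷ [] ]⇓ y

-- The characteristic function of {n}. Recursion on `n` shifts it one place at a time, which avoids
-- coding an equality test.
singletonᶜ : ℕ → Code 1
singletonᶜ zero    = recᶜ (compᶜ sucᶜ (zeroᶜ ∷ [])) (compᶜ zeroᶜ [])
singletonᶜ (suc n) = recᶜ zeroᶜ (compᶜ (singletonᶜ n) (projᶜ zero ∷ []))

-- Convergence is claimed at every `x`, also at `n`: `rec⇓+` needs a value of the recursive call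
-- even though the step code ignores it.
singletonᶜ⇓ : ∀ n x → ∃ λ y → singletonᶜ n [ x ∷ [] ]⇓ y × (x ≢ n → y ≡ 0)
singletonᶜ⇓ zero    zero    =
  1 , rec⇓0 (comp⇓ (zero⇓ ∷ []) suc⇓) , λ 0≢0 → ⊥-elim (0≢0 refl)
singletonᶜ⇓ zero    (suc x) with singletonᶜ⇓ zero x
... | _ , r⇓ , _ = 0 , rec⇓+ r⇓ (comp⇓ [] zero⇓) , λ _ → refl
singletonᶜ⇓ (suc n) zero    = 0 , rec⇓0 zero⇓ , λ _ → refl
singletonᶜ⇓ (suc n) (suc x) with singletonᶜ⇓ (suc n) x | singletonᶜ⇓ n x
... | _ , r⇓ , _ | y , y⇓ , y≡0 =
  y , rec⇓+ r⇓ (comp⇓ (proj⇓ zero ∷ []) y⇓) , λ x≢n → y≡0 (x≢n ∘ cong suc)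

singletonᶜ-self : ∀ n → ¬ singletonᶜ n [ n ∷ [] ]⇓ 0
singletonᶜ-self zero    (rec⇓0 (comp⇓ _ ()))
singletonᶜ-self (suc n) (rec⇓+ _ (comp⇓ (proj⇓ .zero ∷ []) n⇓0)) =
  singletonᶜ-self n n⇓0

-- The searched code ignores the search variable and tests the input alone. The search thus stops at
-- once when the input differs from `n`, and never otherwise.
coSingletonᶜ : ℕ → Code 1
coSingletonᶜ n = minᶜ (compᶜ (singletonᶜ n) (projᶜ (suc zero) ∷ []))

Dom-coSingletonᶜ : ∀ n → (_≢ n) ≐ Dom (coSingletonᶜ n)
Dom-coSingletonᶜ n = converges , diverges
  where
  converges : ∀ {x} → x ≢ n → x ∈ Dom (coSingletonᶜ n)
  converges {x} x≢n with singletonᶜ⇓ n x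
  ... | y , y⇓ , y≡0 =
    0 , min⇓ (comp⇓ (proj⇓ (suc zero) ∷ [])
                    (subst (singletonᶜ n [ x ∷ [] ]⇓_) (y≡0 x≢n) y⇓))
             λ ()
  diverges : ∀ {x} → x ∈ Dom (coSingletonᶜ n) → x ≢ n
  diverges (_ , min⇓ (comp⇓ (proj⇓ .(suc zero) ∷ []) n⇓0) _) refl =
    singletonᶜ-self n n⇓0

Dom-projᶜ : U ≐ Dom (projᶜ zero)
Dom-projᶜ = (λ {x} _ → x , proj⇓ zero) , λ _ → tt

-- `g` restarts at its own index 0 after the prefix, so none of its values is lost.
splice : (ℕ → ℕ) → ℕ → (ℕ → ℕ) → ℕ → ℕ
splice f zero    g j       = g j
splice f (suc l) g zero    = f zero
splice f (suc l) g (suc j) = splice (f ∘ suc) l g j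

splice-< : ∀ f l g {j} → j < l → splice f l g j ≡ f j
splice-< f (suc l) g {zero}  _         = refl
splice-< f (suc l) g {suc j} (s≤s j<l) = splice-< (f ∘ suc) l g j<l

splice-+ : ∀ f l g j → splice f l g (l + j) ≡ g j
splice-+ f zero    g j = refl
splice-+ f (suc l) g j = splice-+ (f ∘ suc) l g j

splice-≢ : ∀ {n} f l g → (∀ j → j < l → f j ≢ n) → (∀ j → g j ≢ n) →
           ∀ j → splice f l g j ≢ n
splice-≢ f zero    g f≢ g≢ j       = g≢ j
splice-≢ f (suc l) g f≢ g≢ zero    = f≢ zero z<s
splice-≢ f (suc l) g f≢ g≢ (suc j) =
  splice-≢ (f ∘ suc) l g (λ i → f≢ (suc i) ∘ s<s) g≢ j

applyUpTo-cong-< : ∀ {f g : ℕ → ℕ} n → (∀ j → j < n → f j ≡ g j) →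
                   applyUpTo f n ≡ applyUpTo g n
applyUpTo-cong-< zero    f≗g = refl
applyUpTo-cong-< (suc n) f≗g =
  cong₂ _∷_ (f≗g zero z<s) (applyUpTo-cong-< n λ j → f≗g (suc j) ∘ s<s)

bounded : ∀ (f : ℕ → ℕ) l → ∃ λ n → ∀ j → j < l → f j < n
bounded f zero    = 0 , λ _ ()
bounded f (suc l) with bounded (f ∘ suc) l
... | n , f< = suc (f zero) ⊔ n , λ
  { zero    _         → m≤m⊔n (suc (f zero)) n
  ; (suc j) (s≤s j<l) → ≤-trans (f< j j<l) (m≤n⊔m (suc (f zero)) n) }

omit : ℕ → ℕ → ℕ
omit zero    j       = suc j
omit (suc n) zero    = zero
omit (suc n) (suc j) = suc (omit n j)

omit-≢ : ∀ n j → omit n j ≢ n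
omit-≢ (suc n) (suc j) = omit-≢ n j ∘ suc-injective

omit-surjective : ∀ n {x} → x ≢ n → ∃ λ j → omit n j ≡ x
omit-surjective zero    {zero}  0≢0 = ⊥-elim (0≢0 refl)
omit-surjective zero    {suc x} _   = x , refl
omit-surjective (suc n) {zero}  _   = 0 , refl
omit-surjective (suc n) {suc x} x≢n with omit-surjective n (x≢n ∘ cong suc)
... | j , eq = suc j , cong suc eq

module Limit (f : ℕ → ℕ → ℕ) (l : ℕ → ℕ)
             (l-increasing : ∀ k → l k < l (suc k))
             (coherent : ∀ k j → j < l k → f (suc k) j ≡ f k j) where

  l-mono : ∀ {k m} → k ≤′ m → l k ≤ l m
  l-mono ≤′-refl       = ≤-refl
  l-mono (≤′-step k≤m) = ≤-trans (l-mono k≤m) (<⇒≤ (l-increasing _))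

  k≤l : ∀ k → k ≤ l k
  k≤l zero    = z≤n
  k≤l (suc k) = ≤-<-trans (k≤l k) (l-increasing k)

  agree : ∀ {k m} → k ≤′ m → ∀ j → j < l k → f m j ≡ f k j
  agree ≤′-refl       j j<l = refl
  agree (≤′-step k≤m) j j<l =
    trans (coherent _ j (<-≤-trans j<l (l-mono k≤m))) (agree k≤m j j<l)

  -- Position `j` is frozen from stage `suc j` on, because `j < l (suc j)` by `k≤l`.
  limit : ℕ → ℕ
  limit j = f (suc j) j

  limit-agrees : ∀ k j → j < l k → limit j ≡ f k j
  limit-agrees k j j<l with ≤-total k (suc j)
  ... | inj₁ k≤ = agree (≤⇒≤′ k≤) j j<l
  ... | inj₂ ≤k = sym (agree (≤⇒≤′ ≤k) j (k≤l (suc j)))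

module _ (N : AcceptableNumbering) where
  open AcceptableNumbering N

  index : ∀ c → ∃ λ e → Dom c ≐ W e
  -- With a dummy first argument, `c` becomes a constant sequence of partial functions, so any
  -- argument of `f`, here 0, yields an index.
  index c with translate (compᶜ c (projᶜ (suc zero) ∷ []))
  ... | f , _ , φ⇔ = f 0 , to , from
    where
    to : ∀ {x} → x ∈ Dom c → x ∈ W (f 0)
    to {x} (y , c⇓) =
      y , Equivalence.from (φ⇔ 0 x y) (comp⇓ (proj⇓ (suc zero) ∷ []) c⇓)
    from : ∀ {x} → x ∈ W (f 0) → x ∈ Dom c
    from {x} (y , φ↓) with Equivalence.to (φ⇔ 0 x y) φ↓
    ... | comp⇓ (proj⇓ .(suc zero) ∷ []) c⇓ = y , c⇓

  index-U : ∃ λ e → U ≐ W e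
  index-U = map₂ (≐-trans Dom-projᶜ) (index (projᶜ zero))

  index-≢ : ∀ n → ∃ λ e → (_≢ n) ≐ W e
  index-≢ n = map₂ (≐-trans (Dom-coSingletonᶜ n)) (index (coSingletonᶜ n))

  OmitsAtMostOne : Pred (Pred ℕ 0ℓ) 0ℓ
  OmitsAtMostOne A = A ≐ U ⊎ ∃ λ n → A ≐ (_≢ n)

  isFamily : IsFamilyOfNonemptyCeSets {N} OmitsAtMostOne
  isFamily = record
    { resp     = λ
      { A≐B (inj₁ A≐U)       → inj₁ (≐-trans (≐-sym A≐B) A≐U)
      ; A≐B (inj₂ (n , A≐≢)) → inj₂ (n , ≐-trans (≐-sym A≐B) A≐≢) }
    ; nonempty = λ
      { (inj₁ A≐U)       → 0 , proj₂ A≐U tt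
      ; (inj₂ (n , A≐≢)) → suc n , proj₂ A≐≢ 1+n≢n }
    ; ce       = λ
      { (inj₁ A≐U)       → map₂ (≐-trans A≐U) index-U
      ; (inj₂ (n , A≐≢)) → map₂ (≐-trans A≐≢) (index-≢ n) }
    }

  E₀-learnable : Learnable (E₀ce N) OmitsAtMostOne
  E₀-learnable = const u , λ e We∈ _ _ → u , almost e We∈ , 0 , λ _ _ → refl
    where
    u : ℕ
    u = proj₁ index-U
    total : ∀ {x} → x ∈ W u
    total = proj₁ (proj₂ index-U) tt
    almost : ∀ e → W e ∈ OmitsAtMostOne → AlmostSameSet N u e
    almost e (inj₁ We≐U) = [] , λ
      { (inj₁ (_ , x∉We)) → ⊥-elim (x∉We (proj₂ We≐U tt))
      ; (inj₂ (_ , x∉Wu)) → ⊥-elim (x∉Wu total) }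
    almost e (inj₂ (n , We≐≢)) = n ∷ [] , λ
      { {x} (inj₁ (_ , x∉We)) → here (≡n x x∉We)
      ; (inj₂ (_ , x∉Wu)) → ⊥-elim (x∉Wu total) }
      where
      -- Membership in `W e` need not be decidable, but equality with `n` is.
      ≡n : ∀ x → ¬ W e x → x ≡ n
      ≡n x x∉We with x ≟ n
      ... | yes x≡n = x≡n
      ... | no  x≢n = ⊥-elim (x∉We (proj₂ We≐≢ x≢n))

  module Adversary (learnable : Learnable (=ce N) OmitsAtMostOne) where

    M : Learner
    M = proj₁ learnable

    -- Of the wrong guess only one missed point is kept: this already prevents it from being an
    -- index of ω.
    record Provoked (f : ℕ → ℕ) (l : ℕ) : Set where
      field
        g       : ℕ → ℕ
        g-<     : ∀ j → j < l → g j ≡ f j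
        s       : ℕ
        l≤s     : l ≤ s
        omitted : ℕ
        M-omits : ¬ W (M (applyUpTo g s)) omitted

    -- Choosing `n` above the first `l` values of `f` lets that prefix continue to an enumeration of
    -- all numbers except `n`, on which the learner has to converge to a correct index.
    provoke : ∀ f l → Provoked f l
    provoke f l with bounded f l
    ... | n , f<n with index-≢ n
    ... | e , ≢≐We
      with proj₂ learnable e (inj₂ (n , ≐-sym ≢≐We)) (splice f l (omit n))
             ( (λ j → proj₁ ≢≐We
                        (splice-≢ f l (omit n) (λ i i<l → <⇒≢ (f<n i i<l))
                                  (omit-≢ n) j))
             , λ x∈ → let j , eq = omit-surjective n (proj₂ ≢≐We x∈)
                      in l + j , trans (splice-+ f l (omit n) j) eq )
    ... | i , Wi≐We , s₀ , M≡i = record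
      { g       = splice f l (omit n)
      ; g-<     = λ j → splice-< f l (omit n)
      -- Long enough to contain the old prefix and to reach convergence.
      ; s       = l ⊔ s₀
      ; l≤s     = m≤m⊔n l s₀
      ; omitted = n
      ; M-omits = λ n∈ → proj₂ ≢≐We
          (proj₁ Wi≐We (subst (λ a → W a n) (M≡i (l ⊔ s₀) (m≤n⊔m l s₀)) n∈))
          refl
      }

    stage : ℕ → (ℕ → ℕ) × ℕ
    text  : ℕ → ℕ → ℕ
    len   : ℕ → ℕ
    reply : ∀ k → Provoked (text k) (len k)

    stage zero    = const 0 , 0
    -- Only the first `k`, at position `s`, lies within the new length; the rest of `const k` is
    -- filler that later stages may replace.
    stage (suc k) = splice (Provoked.g p) (Provoked.s p) (const k)
                  , suc (Provoked.s p)
      where p = reply k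
    text k  = proj₁ (stage k)
    len k   = proj₂ (stage k)
    reply k = provoke (text k) (len k)

    module Reply k = Provoked (reply k)
    open Reply

    open Limit text len (s≤s ∘ l≤s)
      (λ k j j<l → trans (splice-< (g k) (s k) (const k) (<-≤-trans j<l (l≤s k)))
                         (g-< k j j<l))

    limit-g : ∀ k j → j < s k → limit j ≡ g k j
    limit-g k j j<s = trans (limit-agrees (suc k) j (m<n⇒m<1+n j<s))
                            (splice-< (g k) (s k) (const k) j<s)

    -- This makes the limit text an enumeration of ω, although each stage avoids some number for a
    -- while.
    limit-s : ∀ k → limit (s k) ≡ k
    limit-s k = begin
      limit (s k)                              ≡⟨ limit-agrees (suc k) (s k) ≤-refl ⟩
      splice (g k) (s k) (const k) (s k)       ≡⟨ cong (splice (g k) (s k) (const k)) (+-identityʳ (s k)) ⟨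
      splice (g k) (s k) (const k) (s k + 0)   ≡⟨ splice-+ (g k) (s k) (const k) 0 ⟩
      k                                        ∎
      where open ≡-Reasoning

    M-limit-omits : ∀ k → ¬ W (M (applyUpTo limit (s k))) (omitted k)
    M-limit-omits k =
      M-omits k ∘ subst (λ xs → W (M xs) (omitted k))
                        (applyUpTo-cong-< (s k) (limit-g k))

    ¬learnable : ∀ {e} → ¬ (U ≐ W e)
    ¬learnable {e} U≐We
      with proj₂ learnable e (inj₁ (≐-sym U≐We)) limit
             ((λ _ → proj₁ U≐We tt) , λ {x} _ → s x , limit-s x)
    -- The convergence bound `k` doubles as a stage number: since `k ≤ len k ≤ s k`, the guess at
    -- `s k` is already the final index `i` of ω, yet it misses `omitted k`.
    ... | i , Wi≐We , k , M≡i =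
      M-limit-omits k
        (subst (λ a → W a (omitted k))
               (sym (M≡i (s k) (≤-trans (k≤l k) (l≤s k))))
               (proj₂ Wi≐We (proj₁ U≐We tt)))

  ¬=ce-learnable : ¬ Learnable (=ce N) OmitsAtMostOne
  ¬=ce-learnable learnable =
    Adversary.¬learnable learnable (proj₂ index-U)

  -- The same learner works, since its limit guess is related to `e` by any relation extending
  -- equality.
  =ce-learnable⇒learnable : ∀ (E : CeEquivalence N) 𝔎 →
                            Learnable (=ce N) 𝔎 → Learnable {N} E 𝔎
  =ce-learnable⇒learnable E 𝔎 (M , learns) = M , λ e We∈ μ μ-enum →
    let i , i=e , converges = learns e We∈ μ μ-enum
    in i , CeEquivalence.extends E i=e , converges

proposition5p1 : (N : AcceptableNumbering) → =ce N <Learn E₀ce N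
proposition5p1 N =
    (λ 𝔎 _ → =ce-learnable⇒learnable N (E₀ce N) 𝔎)
  , λ E₀≤= → ¬=ce-learnable N
               (E₀≤= (OmitsAtMostOne N) (isFamily N) (E₀-learnable N))
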